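{- For non-empty rooted trees $P,R,S$, let $T_1=T_1(P,R,S)$ be the rooted tree whose root $a$ has exactly two children, a node $y$ and the root of a copy of $S$, where $y$ has exactly two children, the root of a copy of $P$ and the root of a copy of $R$. Let $T_2=T_2(P,R,S)$ be the rooted tree whose root $a$ has exactly two children, the root of a copy of $P$ and a node $z$, where $z$ has exactly two children, the root of a copy of $R$ and the root of a copy of $S$. There exist non-empty rooted trees $P,R,S$, with $P$ not isomorphic to $S$, such that every largest common minor $T_\mu$ of $T_1$ and $T_2$ has size $|T_\mu|=|T_1|-1$, while every smallest common supertree $T_\sigma$ of $T_1$ and $T_2$ under minor embeddings has size $|T_\sigma|>|T_1|+1$. In particular, the equality $|T_\sigma|=|T_1|+|T_2|-|T_\mu|$ does not hold for all pairs of trees $T_1,T_2$.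
   Context: A (rooted) tree is a finite directed graph $T=(V(T),E(T))$, without loops, which is either empty or has a distinguished node $r$ (the root) such that for every other node $v$ there is exactly one directed path from $r$ to $v$; arcs point from parent to child. Trees are unordered. The size $|T|$ is the number of nodes of $T$. A tree $S$ is a minor of a tree $T$ if there is an injective map $f:V(S)\to V(T)$ (a minor embedding $f:S\to T$) such that for every arc $(u,v)\in E(S)$ there is a directed path from $f(u)$ to $f(v)$ in $T$ with no intermediate node in $f(V(S))$. A largest common minor of trees $T_1,T_2$ is a tree that is a minor of both and has the largest size among all such trees. A smallest common supertree of $T_1,T_2$ under minor embeddings is a tree of which both $T_1$ and $T_2$ are minors and that has the least size among all such trees. -}

module Defs where

open import Data.Bool.Base using (Bool; true; false; T)
open import Data.Bool.Properties using (T-irrelevant)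
open import Data.Empty using (⊥-elim)
open import Data.Fin.Base using (Fin; zero; suc; splitAt; _↑ˡ_; _↑ʳ_)
open import Data.Fin.Properties using (_≟_; ↑ˡ-injective; ↑ʳ-injective; splitAt-↑ˡ; splitAt-↑ʳ; splitAt⁻¹-↑ˡ; splitAt⁻¹-↑ʳ)
  renaming (suc-injective to Fin-suc-injective)
open import Data.List.Base using (List; []; _∷_)
open import Data.List.Relation.Unary.All using (All)
open import Data.Nat.Base using (ℕ; suc; _+_; _≤_)
open import Data.Nat.Properties using (suc-injective; 1+n≢0; m+n≡0⇒n≡0)
open import Data.Product using (∃; _×_; _,_; proj₁; proj₂; Σ-syntax)
open import Data.Sum.Base using (_⊎_; inj₁; inj₂)
open import Function.Base using (case_of_)
open import Function.Bundles using (_↔_; _↣_; module Inverse; module Injection)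
open import Relation.Binary.Construct.Closure.ReflexiveTransitive using (Star; ε; _◅_; _◅◅_; gmap)
open import Relation.Binary.PropositionalEquality
open import Relation.Nullary using (¬_; Dec; yes; no; does)

-- A finite directed graph without loops, with node set Fin size.
record Digraph : Set where
  field
    size     : ℕ
    arc      : Fin size → Fin size → Bool
    loopless : ∀ v → ¬ T (arc v v)

  Node : Set
  Node = Fin size

  _⟶_ : Node → Node → Set
  u ⟶ v = T (arc u v)

  -- A directed path is a composable sequence of arcs; nodes may repeat.  This
  -- is what makes "exactly one path" below exclude directed cycles.
  Path : Node → Node → Set
  Path = Star _⟶_

  interior : ∀ {u v} → Path u v → List Node
  interior ε                           = []
  interior (_ ◅ ε)                     = []
  interior (_◅_ {j = w} _ p@(_ ◅ _))   = w ∷ interior p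

  IsRoot : Node → Set
  IsRoot r = ∀ v → v ≢ r → Σ[ p ∈ Path r v ] (∀ (q : Path r v) → q ≡ p)

open Digraph public using (Node; Path; interior; IsRoot)

record RootedTree : Set where
  field
    digraph : Digraph
    root    : Node digraph
    isRoot  : IsRoot digraph root

emptyDigraph : Digraph
emptyDigraph = record { size = 0 ; arc = λ () ; loopless = λ () }

data Tree : Set where
  empty    : Tree
  nonEmpty : RootedTree → Tree

graph : Tree → Digraph
graph empty        = emptyDigraph
graph (nonEmpty t) = RootedTree.digraph t

∣_∣ : Tree → ℕ
∣ t ∣ = Digraph.size (graph t)

-- Digraph isomorphism; the root of a rooted tree is its only node without
-- incoming arcs, so it is preserved automatically.
_≅_ : RootedTree → RootedTree → Set
t ≅ t′ = Σ[ f ∈ Node G ↔ Node H ]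
           (∀ u v → Digraph.arc G u v ≡ Digraph.arc H (Inverse.to f u) (Inverse.to f v))
  where
  G = RootedTree.digraph t
  H = RootedTree.digraph t′

IsMinorEmbedding : (S T : Tree) → (Node (graph S) ↣ Node (graph T)) → Set
IsMinorEmbedding S T f =
  ∀ u v → Digraph._⟶_ (graph S) u v →
    Σ[ p ∈ Path (graph T) (to u) (to v) ]
      All (λ w → ¬ (∃ λ x → to x ≡ w)) (interior (graph T) p)
  where open Injection f using (to)

_IsMinorOf_ : Tree → Tree → Set
S IsMinorOf T = ∃ (IsMinorEmbedding S T)

IsCommonMinor : Tree → Tree → Tree → Set
IsCommonMinor T₁ T₂ M = M IsMinorOf T₁ × M IsMinorOf T₂

IsLargestCommonMinor : Tree → Tree → Tree → Set
IsLargestCommonMinor T₁ T₂ M =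
  IsCommonMinor T₁ T₂ M × (∀ M′ → IsCommonMinor T₁ T₂ M′ → ∣ M′ ∣ ≤ ∣ M ∣)

IsCommonSupertree : Tree → Tree → Tree → Set
IsCommonSupertree T₁ T₂ U = T₁ IsMinorOf U × T₂ IsMinorOf U

IsSmallestCommonSupertree : Tree → Tree → Tree → Set
IsSmallestCommonSupertree T₁ T₂ U =
  IsCommonSupertree T₁ T₂ U × (∀ U′ → IsCommonSupertree T₁ T₂ U′ → ∣ U ∣ ≤ ∣ U′ ∣)

pathLength : ∀ (G : Digraph) {u v} → Path G u v → ℕ
pathLength G ε       = 0
pathLength G (_ ◅ p) = suc (pathLength G p)

pathLength-◅◅ : ∀ (G : Digraph) {u v w} (p : Path G u v) (q : Path G v w) →
                pathLength G (p ◅◅ q) ≡ pathLength G p + pathLength G q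
pathLength-◅◅ G ε       q = refl
pathLength-◅◅ G (_ ◅ p) q = cong suc (pathLength-◅◅ G p q)

-- Every node, the root included, is reached from the root by exactly one path.
uniquePath : (t : RootedTree) → ∀ v →
             Σ[ p ∈ Path (RootedTree.digraph t) (RootedTree.root t) v ] (∀ q → q ≡ p)
uniquePath t v with v ≟ RootedTree.root t
... | no v≢r   = RootedTree.isRoot t v v≢r
... | yes refl = ε , closed
  where
  open RootedTree t
  closed : ∀ (q : Path digraph root root) → q ≡ ε
  closed ε = refl
  closed (_◅_ {j = x} e q) with x ≟ root
  ... | yes refl = ⊥-elim (Digraph.loopless digraph root e)
  ... | no x≢r   = ⊥-elim (1+n≢0 (m+n≡0⇒n≡0 (pathLength digraph q) (trans (sym (pathLength-◅◅ digraph q (e ◅ ε))) (sym 0≡))))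
    where
    unique = proj₂ (isRoot x x≢r)
    0≡ : 0 ≡ pathLength digraph (q ◅◅ (e ◅ ε))
    0≡ = suc-injective (cong (pathLength digraph) (trans (unique (e ◅ ε)) (sym (unique (e ◅ (q ◅◅ (e ◅ ε)))))))

-- join A B is the tree whose root has exactly two children: the root of a copy
-- of A and the root of a copy of B.  Node zero is the new root; the remaining
-- nodes are those of A followed by those of B.
module Join (A B : RootedTree) where
  module A = RootedTree A
  module B = RootedTree B
  module GA = Digraph A.digraph
  module GB = Digraph B.digraph

  rootArc : GA.Node ⊎ GB.Node → Bool
  rootArc (inj₁ i) = does (i ≟ A.root)
  rootArc (inj₂ j) = does (j ≟ B.root)

  innerArc : GA.Node ⊎ GB.Node → GA.Node ⊎ GB.Node → Bool
  innerArc (inj₁ i) (inj₁ i′) = GA.arc i i′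
  innerArc (inj₂ j) (inj₂ j′) = GB.arc j j′
  innerArc (inj₁ _) (inj₂ _)  = false
  innerArc (inj₂ _) (inj₁ _)  = false

  joinArc : Fin (suc (GA.size + GB.size)) → Fin (suc (GA.size + GB.size)) → Bool
  joinArc zero    zero    = false
  joinArc zero    (suc v) = rootArc (splitAt GA.size v)
  joinArc (suc u) zero    = false
  joinArc (suc u) (suc v) = innerArc (splitAt GA.size u) (splitAt GA.size v)

  joinLoopless : ∀ v → ¬ T (joinArc v v)
  joinLoopless (suc v) e with splitAt GA.size v
  ... | inj₁ i = GA.loopless i e
  ... | inj₂ j = GB.loopless j e

  joinDigraph : Digraph
  joinDigraph = record
    { size = suc (GA.size + GB.size) ; arc = joinArc ; loopless = joinLoopless }

  module G = Digraph joinDigraph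

  -- The case distinction over the two copies is made once and for all by
  -- treating a copy as a full subgraph that no arc leaves.
  module Copy (C : RootedTree)
              (ι : Node (RootedTree.digraph C) → G.Node)
              (full : ∀ i j → G.arc (ι i) (ι j) ≡ Digraph.arc (RootedTree.digraph C) i j)
              (ι-closed : ∀ i v → G._⟶_ (ι i) v → ∃ λ j → ι j ≡ v)
              (ι-injective : ∀ {i j} → ι i ≡ ι j → i ≡ j)
    where

    open RootedTree C

    lift : ∀ {i j} → Path digraph i j → Path joinDigraph (ι i) (ι j)
    lift = gmap ι (λ {i} {j} → subst T (sym (full i j)))

    data Lifted {i} : ∀ {v} → Path joinDigraph (ι i) v → Set where
      lifted : ∀ {j} (p : Path digraph i j) → Lifted (lift p)

    isLifted : ∀ {i v} (q : Path joinDigraph (ι i) v) → Lifted q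
    isLifted ε = lifted ε
    isLifted {i} (e ◅ q) with ι-closed i _ e
    ... | j , refl with isLifted q
    ...   | lifted p = subst (λ e′ → Lifted (e′ ◅ lift p)) (T-irrelevant _ _)
                         (lifted (subst T (full i j) e ◅ p))

    lifted-unique : ∀ {i j} (p : Path digraph i j) → (∀ p′ → p′ ≡ p) →
                    ∀ {v} {q : Path joinDigraph (ι i) v} → Lifted q →
                    (eq : ι j ≡ v) → q ≡ subst (Path joinDigraph (ι i)) eq (lift p)
    lifted-unique p unique (lifted p′) eq with ι-injective eq
    lifted-unique p unique (lifted p′) refl | refl = cong lift (unique p′)

    pathTo : G._⟶_ zero (ι root) →
             (∀ w → G._⟶_ zero w → w ≡ ι root ⊎ (∀ i → ¬ Path joinDigraph w (ι i))) →
             ∀ i → ι i ≢ zero →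
             Σ[ p ∈ Path joinDigraph zero (ι i) ] (∀ q → q ≡ p)
    pathTo top children i ιi≢0 = path , λ q → unique q refl
      where
      path : Path joinDigraph zero (ι i)
      path = top ◅ lift (proj₁ (uniquePath C i))

      unique : ∀ {v} (q : Path joinDigraph zero v) (eq : v ≡ ι i) →
               subst (Path joinDigraph zero) eq q ≡ path
      unique ε       eq = ⊥-elim (ιi≢0 (sym eq))
      unique (e ◅ q) refl with children _ e
      ... | inj₂ unreachable = ⊥-elim (unreachable i q)
      ... | inj₁ refl = cong₂ _◅_ (T-irrelevant e top)
                          (lifted-unique _ (proj₂ (uniquePath C i)) (isLifted q) refl)

  ιA : GA.Node → G.Node
  ιA i = suc (i ↑ˡ GB.size)

  ιB : GB.Node → G.Node
  ιB j = suc (GA.size ↑ʳ j)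

  splitA : ∀ i → splitAt GA.size (i ↑ˡ GB.size) ≡ inj₁ i
  splitA i = splitAt-↑ˡ GA.size i GB.size

  splitB : ∀ j → splitAt GA.size (GA.size ↑ʳ j) ≡ inj₂ j
  splitB = splitAt-↑ʳ GA.size GB.size

  data Position : G.Node → Set where
    top : Position zero
    inA : ∀ i → Position (ιA i)
    inB : ∀ j → Position (ιB j)

  position : ∀ v → Position v
  position zero    = top
  position (suc v) with splitAt GA.size v in eq
  ... | inj₁ i = subst (λ w → Position (suc w)) (splitAt⁻¹-↑ˡ eq) (inA i)
  ... | inj₂ j = subst (λ w → Position (suc w)) (splitAt⁻¹-↑ʳ {GA.size} eq) (inB j)

  A≢B : ∀ {i j} → ιA i ≢ ιB j
  A≢B {i} {j} eq =
    case trans (sym (splitA i)) (trans (cong (splitAt GA.size) (Fin-suc-injective eq)) (splitB j)) of λ ()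

  A-full : ∀ i j → G.arc (ιA i) (ιA j) ≡ GA.arc i j
  A-full i j = cong₂ innerArc (splitA i) (splitA j)

  B-full : ∀ i j → G.arc (ιB i) (ιB j) ≡ GB.arc i j
  B-full i j = cong₂ innerArc (splitB i) (splitB j)

  A-closed : ∀ i v → G._⟶_ (ιA i) v → ∃ λ j → ιA j ≡ v
  A-closed i v e with position v
  ... | inA j = j , refl
  ... | inB j = ⊥-elim (subst T (cong₂ innerArc (splitA i) (splitB j)) e)

  B-closed : ∀ i v → G._⟶_ (ιB i) v → ∃ λ j → ιB j ≡ v
  B-closed i v e with position v
  ... | inA j = ⊥-elim (subst T (cong₂ innerArc (splitB i) (splitA j)) e)
  ... | inB j = j , refl

  A-injective : ∀ {i j} → ιA i ≡ ιA j → i ≡ j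
  A-injective eq = ↑ˡ-injective GB.size _ _ (Fin-suc-injective eq)

  B-injective : ∀ {i j} → ιB i ≡ ιB j → i ≡ j
  B-injective eq = ↑ʳ-injective GA.size _ _ (Fin-suc-injective eq)

  module CopyA = Copy A ιA A-full A-closed A-injective
  module CopyB = Copy B ιB B-full B-closed B-injective

  A-isolated : ∀ {i v} → Path joinDigraph (ιA i) v → ∀ j → v ≢ ιB j
  A-isolated q j eq with CopyA.isLifted q
  ... | CopyA.lifted _ = A≢B eq

  B-isolated : ∀ {j v} → Path joinDigraph (ιB j) v → ∀ i → v ≢ ιA i
  B-isolated q i eq with CopyB.isLifted q
  ... | CopyB.lifted _ = A≢B (sym eq)

  rootArcA : ∀ i → G.arc zero (ιA i) ≡ does (i ≟ A.root)
  rootArcA i = cong rootArc (splitA i)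

  rootArcB : ∀ j → G.arc zero (ιB j) ≡ does (j ≟ B.root)
  rootArcB j = cong rootArc (splitB j)

  decided : ∀ {P : Set} (P? : Dec P) → T (does P?) → P
  decided (yes p) _ = p

  decide : ∀ {P : Set} (P? : Dec P) → P → T (does P?)
  decide (yes _) _ = _
  decide (no ¬p) p = ¬p p

  childrenA : ∀ w → G._⟶_ zero w → w ≡ ιA A.root ⊎ (∀ i → ¬ Path joinDigraph w (ιA i))
  childrenA w e with position w
  ... | inA i = inj₁ (cong ιA (decided (i ≟ A.root) (subst T (rootArcA i) e)))
  ... | inB j = inj₂ (λ i q → B-isolated q i refl)

  childrenB : ∀ w → G._⟶_ zero w → w ≡ ιB B.root ⊎ (∀ j → ¬ Path joinDigraph w (ιB j))
  childrenB w e with position w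
  ... | inA i = inj₂ (λ j q → A-isolated q j refl)
  ... | inB j = inj₁ (cong ιB (decided (j ≟ B.root) (subst T (rootArcB j) e)))

  zeroIsRoot : IsRoot joinDigraph zero
  zeroIsRoot v v≢0 with position v
  ... | top   = ⊥-elim (v≢0 refl)
  ... | inA i = CopyA.pathTo (subst T (sym (rootArcA A.root)) (decide (A.root ≟ A.root) refl))
                             childrenA i v≢0
  ... | inB j = CopyB.pathTo (subst T (sym (rootArcB B.root)) (decide (B.root ≟ B.root) refl))
                             childrenB j v≢0

join : RootedTree → RootedTree → RootedTree
join A B = record
  { digraph = Join.joinDigraph A B ; root = zero ; isRoot = Join.zeroIsRoot A B }

tree₁ : RootedTree → RootedTree → RootedTree → Tree
tree₁ P R S = nonEmpty (join (join P R) S)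

tree₂ : RootedTree → RootedTree → RootedTree → Tree
tree₂ P R S = nonEmpty (join P (join R S))

{-# OPTIONS --safe #-}
module Submission where

-- A minor embedding preserves and reflects the ancestor order, so the
-- minors of a tree are induced suborders of it.  Take P and R to be single nodes and
-- S a chain of three nodes.  Then T₁ and T₂ have seven nodes; T₂ contains the
-- strict chain a < z < s₁ < s₂ < s₃, whereas a < s₁ < s₂ < s₃ is the only strict
-- chain of four nodes in T₁.  Hence T₁ and T₂ are not isomorphic, and contracting
-- y or z gives a common minor with six nodes.
--
-- In a common supertree with at most eight nodes, all nodes of T₂ but at most one
-- are also nodes of T₁.  If z is the exception, then y and z are both above R and
-- thus comparable, but y is not above s₁ and z is not above P.  If a is the
-- exception, then z is matched with the root of T₁, which is above P.  If it is
-- one of the sᵢ, then z is matched with s₁ of T₁, whose descendants form a chain, so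
-- that R is comparable to the remaining sᵢ.  If it is none of these, T₁ has a strict
-- chain of five nodes.

open import Data.Bool.Base using (Bool; false; T)
open import Data.Bool.Properties using (T-irrelevant)
open import Data.Empty using (⊥; ⊥-elim)
open import Data.Fin.Base using (Fin; zero; suc; toℕ; inject₁)
open import Data.Fin.Patterns using (0F; 1F; 2F; 3F; 4F; 5F; 6F; 7F; 8F)
open import Data.Fin.Permutation using (↔⇒≡)
open import Data.Fin.Properties using (_≟_; all?; any?; ¬Fin0; injective⇒≤; toℕ-inject₁)
open import Data.List.Base using (List; []; _∷_)
open import Data.List.Membership.Propositional using (_∈_)
open import Data.List.Relation.Unary.All using (All; lookup) renaming (all? to allList?)
open import Data.List.Relation.Unary.Any using (here; there) renaming (any? to anyList?)
open import Data.Nat.Base using (ℕ; zero; suc; _+_; _∸_; _>_; _≤_; _<_; z≤n; s≤s)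
open import Data.Nat.Properties using (≤-reflexive; ≤-refl; ≤-trans; ≤-antisym; <-irrefl; ≰⇒>; ≮⇒≥; _≤?_)
open import Data.Product using (∃; _×_; _,_; proj₁; proj₂; ∃-syntax; Σ-syntax)
open import Data.Sum.Base as Sum using (_⊎_; inj₁; inj₂)
open import Data.Vec.Base as Vec using (Vec; []; _∷_)
open import Data.Vec.Functional as Vector using ()
open import Function.Base using (_∘_; case_of_)
open import Function.Bundles using (_↣_; mk↣; module Injection)
open import Function.Definitions using (Injective)
open import Relation.Binary.Construct.Closure.ReflexiveTransitive using (Star; ε; _◅_; _◅◅_)
open import Relation.Binary.PropositionalEquality
open import Relation.Nullary using (¬_; Dec; yes; no; does; ¬?; contradiction; _×-dec_; _→-dec_)
open import Relation.Nullary.Decidable using (True; toWitness; T?; from-yes; from-no; map′; decidable-stable)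
open import Defs

-- Injections between finite sets

∷-injective : ∀ {m n} {f : Fin m → Fin n} {x} → Injective _≡_ _≡_ f → (∀ i → f i ≢ x) →
              Injective _≡_ _≡_ (x Vector.∷ f)
∷-injective inj fresh {zero}  {zero}  _  = refl
∷-injective inj fresh {zero}  {suc j} eq = contradiction (sym eq) (fresh j)
∷-injective inj fresh {suc i} {zero}  eq = contradiction eq (fresh i)
∷-injective inj fresh {suc i} {suc j} eq = cong suc (inj eq)

injective∧≤⇒surjective : ∀ {m n} {f : Fin m → Fin n} → Injective _≡_ _≡_ f → n ≤ m →
                         ∀ x → ∃ λ i → f i ≡ x
injective∧≤⇒surjective {f = f} inj n≤m x with any? (λ i → f i ≟ x)
... | yes hit = hit
... | no ¬hit = contradiction
  (≤-trans (injective⇒≤ (∷-injective inj λ i eq → ¬hit (i , eq))) n≤m) (<-irrefl refl)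

-- Two distinct omitted points would extend `f` to an injection from `2 + m` points into at most
-- `1 + m`.
omits-at-most-one : ∀ {m n} {f : Fin m → Fin n} → Injective _≡_ _≡_ f → n ≤ suc m →
                    ∀ {x y} → ¬ (∃ λ i → f i ≡ x) → ¬ (∃ λ i → f i ≡ y) → x ≡ y
omits-at-most-one {f = f} inj n≤1+m {x} {y} ¬x ¬y = decidable-stable (x ≟ y) λ x≢y →
  contradiction (≤-trans (injective⇒≤ (∷-injective (∷-injective inj λ i eq → ¬x (i , eq)) (fresh x≢y))) n≤1+m)
                (<-irrefl refl)
  where
  fresh : x ≢ y → ∀ i → (x Vector.∷ f) i ≢ y
  fresh x≢y zero    eq = x≢y eq
  fresh x≢y (suc i) eq = ¬y (i , eq)

-- Paths in rooted trees

◅◅-cancelˡ : ∀ {A : Set} {R : A → A → Set} {x y z} (r : Star R x y) {p q : Star R y z} →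
             r ◅◅ p ≡ r ◅◅ q → p ≡ q
◅◅-cancelˡ ε       eq = eq
◅◅-cancelˡ (_ ◅ r) eq = ◅◅-cancelˡ r (tail eq)
  where
  tail : ∀ {A : Set} {R : A → A → Set} {x y z} {e : R x y} {p q : Star R y z} →
         e ◅ p ≡ e ◅ q → p ≡ q
  tail refl = refl

module Walk (G : Digraph) where

  nodes : ∀ {u v} → Path G u v → List (Node G)
  nodes {u} ε       = u ∷ []
  nodes {u} (_ ◅ p) = u ∷ nodes p

  prefix : ∀ {u v w} (p : Path G u v) → w ∈ nodes p → Path G u w
  prefix ε       (here refl) = ε
  prefix (_ ◅ _) (here refl) = ε
  prefix (e ◅ p) (there w∈p) = e ◅ prefix p w∈p

  suffix : ∀ {u v w} (p : Path G u v) → w ∈ nodes p → Path G w v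
  suffix ε       (here refl) = ε
  suffix (e ◅ p) (here refl) = e ◅ p
  suffix (_ ◅ p) (there w∈p) = suffix p w∈p

  start∈nodes : ∀ {u v} (p : Path G u v) → u ∈ nodes p
  start∈nodes ε       = here refl
  start∈nodes (_ ◅ _) = here refl

  midpoint∈nodes : ∀ {u v w} (p : Path G u w) (q : Path G w v) → w ∈ nodes (p ◅◅ q)
  midpoint∈nodes ε       q = start∈nodes q
  midpoint∈nodes (_ ◅ p) q = there (midpoint∈nodes p q)

  nodes-comparable : ∀ {u v x y} (p : Path G u v) → x ∈ nodes p → y ∈ nodes p →
                     Path G x y ⊎ Path G y x
  nodes-comparable ε         (here refl) (here refl) = inj₁ ε
  nodes-comparable p@(_ ◅ _) (here refl) y∈p         = inj₁ (prefix p y∈p)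
  nodes-comparable p@(_ ◅ _) (there x∈p) (here refl) = inj₂ (prefix p (there x∈p))
  nodes-comparable (_ ◅ p)   (there x∈p) (there y∈p) = nodes-comparable p x∈p y∈p

  nodes⊆ends∪interior : ∀ {u v w} (p : Path G u v) → w ∈ nodes p →
                        w ≡ u ⊎ w ≡ v ⊎ w ∈ interior G p
  nodes⊆ends∪interior ε             (here refl)         = inj₁ refl
  nodes⊆ends∪interior (_ ◅ _)       (here refl)         = inj₁ refl
  nodes⊆ends∪interior (_ ◅ ε)       (there (here refl)) = inj₂ (inj₁ refl)
  nodes⊆ends∪interior (_ ◅ p@(_ ◅ _)) (there w∈p) with nodes⊆ends∪interior p w∈p
  ... | inj₁ refl        = inj₂ (inj₂ (here refl))
  ... | inj₂ (inj₁ refl) = inj₂ (inj₁ refl)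
  ... | inj₂ (inj₂ w∈i)  = inj₂ (inj₂ (there w∈i))

  data Snoc {u} : ∀ {v} → Path G u v → Set where
    ε    : Snoc ε
    _◅ʳ_ : ∀ {v w} (p : Path G u v) (e : Digraph._⟶_ G v w) → Snoc (p ◅◅ (e ◅ ε))

  snoc : ∀ {u v} (p : Path G u v) → Snoc p
  snoc ε       = ε
  snoc (e ◅ p) with snoc p
  ... | ε      = ε ◅ʳ e
  ... | q ◅ʳ f = (e ◅ q) ◅ʳ f

-- The ancestor order of a rooted tree

module Order (t : RootedTree) where
  open RootedTree t
  open Walk digraph

  infix 4 _≼_ _≺_ _≼?_ _≺?_

  _≼_ : Node digraph → Node digraph → Set
  _≼_ = Path digraph

  _≺_ : Node digraph → Node digraph → Set
  u ≺ v = u ≼ v × u ≢ v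

  -- Prefixed by the path from the root to `u`, both become paths from the root to `v`, hence equal;
  -- the prefix then cancels.
  path-irrelevant : ∀ {u v} (p q : u ≼ v) → p ≡ q
  path-irrelevant {u} {v} p q = ◅◅-cancelˡ (proj₁ (uniquePath t u))
    (trans (proj₂ (uniquePath t v) _) (sym (proj₂ (uniquePath t v) _)))

  ≼-antisym : ∀ {u v} → u ≼ v → v ≼ u → u ≡ v
  ≼-antisym ε       q = refl
  ≼-antisym (e ◅ p) q with path-irrelevant ((e ◅ p) ◅◅ q) ε
  ... | ()

  between : ∀ {u v w} → u ≼ w → w ≼ v → (p : u ≼ v) → w ∈ nodes p
  between q r p = subst (λ p → _ ∈ nodes p) (path-irrelevant (q ◅◅ r) p) (midpoint∈nodes q r)

  -- Both nodes lie on the unique path from the root to `w`.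
  ancestors-comparable : ∀ {u v w} → u ≼ w → v ≼ w → u ≼ v ⊎ v ≼ u
  ancestors-comparable {u} {v} {w} p q = nodes-comparable (proj₁ (uniquePath t w))
    (between (proj₁ (uniquePath t u)) p _) (between (proj₁ (uniquePath t v)) q _)

  _≼?_ : ∀ u v → Dec (u ≼ v)
  u ≼? v = map′ (suffix (proj₁ (uniquePath t v)))
                (λ p → between (proj₁ (uniquePath t u)) p (proj₁ (uniquePath t v)))
                (anyList? (u ≟_) (nodes (proj₁ (uniquePath t v))))

  _≺?_ : ∀ u v → Dec (u ≺ v)
  u ≺? v = (u ≼? v) ×-dec ¬? (u ≟ v)

-- Minor embeddings as order embeddings

module Embedding {s t : RootedTree} (emb : nonEmpty s IsMinorOf nonEmpty t) where
  private
    module S = Order s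
    module T = Order t
  open Injection (proj₁ emb) public using () renaming (to to f; injective to f-injective)

  f-mono : ∀ {u v} → u S.≼ v → f u T.≼ f v
  f-mono ε       = ε
  f-mono (e ◅ p) = proj₁ (proj₂ emb _ _ e) ◅◅ f-mono p

  -- Walk down from x to v: the image of an arc skips no node of the image of f,
  -- so f u is met at the image of one of the nodes walked through.
  f-cancel-from : ∀ {x u v} → x S.≼ v → f x T.≼ f u → f u T.≼ f v → u S.≼ v
  f-cancel-from ε p q with f-injective (T.≼-antisym p q)
  ... | refl = ε
  f-cancel-from {x} {u} (_◅_ {j = y} e r) p q with T.ancestors-comparable (f-mono r) q
  ... | inj₁ fy≼fu = f-cancel-from r fy≼fu q
  ... | inj₂ fu≼fy with proj₂ emb x y e
  ...   | arc , avoids with Walk.nodes⊆ends∪interior (RootedTree.digraph t) arc (T.between p fu≼fy arc)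
  ...     | inj₁ fu≡fx       = subst (S._≼ _) (sym (f-injective fu≡fx)) (e ◅ r)
  ...     | inj₂ (inj₁ fu≡fy) = subst (S._≼ _) (sym (f-injective fu≡fy)) r
  ...     | inj₂ (inj₂ fu∈)   = contradiction (u , refl) (lookup avoids fu∈)

  -- The walk starts at the root of `s`, whose image lies above every `f u` by monotonicity.
  f-cancel : ∀ {u v} → f u T.≼ f v → u S.≼ v
  f-cancel {u} {v} = f-cancel-from (proj₁ (uniquePath s v)) (f-mono (proj₁ (uniquePath s u)))

-- There is at most one path between two given nodes, so only its interior has to be tested.
isMinorEmbedding? : ∀ s t f → Dec (IsMinorEmbedding (nonEmpty s) (nonEmpty t) f)
isMinorEmbedding? s t f = all? λ u → all? λ v → T? _ →-dec avoidingPath? (to u) (to v)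
  where
  open Injection f using (to)
  open Order t

  avoidingPath? : ∀ x y → Dec (Σ[ p ∈ x ≼ y ] All (λ w → ¬ (∃ λ u → to u ≡ w)) (interior _ p))
  avoidingPath? x y with x ≼? y
  ... | no x⋠y = no (x⋠y ∘ proj₁)
  ... | yes p  = map′ (p ,_) (λ { (q , avoids) → subst (All _ ∘ interior _) (path-irrelevant q p) avoids })
                      (allList? (λ w → ¬? (any? λ u → to u ≟ w)) (interior _ p))

-- Trees from parent functions

-- The parent of node `suc v` is `parent v`. The bound gives every parent a smaller number than its
-- child, which excludes loops and makes induction towards the root possible.
module FromParents {n} (parent : Fin n → Fin (suc n)) (parent≤ : ∀ v → toℕ (parent v) ≤ toℕ v) where

  parentDigraph : Digraph
  parentDigraph = record { size = suc n ; arc = arc ; loopless = loopless }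
    where
    arc : Fin (suc n) → Fin (suc n) → Bool
    arc u zero    = false
    arc u (suc v) = does (parent v ≟ u)

    loopless : ∀ v → ¬ T (arc v v)
    loopless (suc v) e with parent v ≟ suc v | parent≤ v
    ... | yes eq | pv≤v = <-irrefl refl (subst (λ w → toℕ w ≤ toℕ v) eq pv≤v)

  open Digraph parentDigraph using (_⟶_)
  open Walk parentDigraph

  parent⟶ : ∀ v → parent v ⟶ suc v
  parent⟶ v with parent v ≟ parent v
  ... | yes _ = _
  ... | no ≢  = ≢ refl

  ⟶⇒parent : ∀ {u} v → u ⟶ suc v → parent v ≡ u
  ⟶⇒parent {u} v e with parent v ≟ u
  ... | yes eq = eq

  -- The last arc of a path to `suc v` must come from `parent v`. As `parent v` is not structurally
  -- smaller than `suc v`, the recursion is on the bound `k`.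
  pathBelow : ∀ k v → toℕ v < k → Σ[ p ∈ Path parentDigraph zero v ] (∀ q → q ≡ p)
  pathBelow k       zero    _         = ε , λ q → closed (snoc q)
    where
    closed : ∀ {q : Path parentDigraph zero zero} → Snoc q → q ≡ ε
    closed ε        = refl
    closed (_ ◅ʳ ())
  pathBelow (suc k) (suc v) (s≤s v<k) with pathBelow k (parent v) (≤-trans (s≤s (parent≤ v)) v<k)
  ... | p , unique = p ◅◅ (parent⟶ v ◅ ε) , λ q → through (snoc q)
    where
    through : ∀ {q : Path parentDigraph zero (suc v)} → Snoc q → q ≡ p ◅◅ (parent⟶ v ◅ ε)
    through (q ◅ʳ e) with ⟶⇒parent v e
    ... | refl = cong₂ (λ q e → q ◅◅ (e ◅ ε)) (unique q) (T-irrelevant e _)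

  parentTree : RootedTree
  parentTree = record
    { digraph = parentDigraph ; root = zero ; isRoot = λ v _ → pathBelow _ v ≤-refl }

open FromParents using (parentTree)

chain : ℕ → RootedTree
chain n = parentTree {n} inject₁ (λ v → ≤-reflexive (toℕ-inject₁ v))

-- The trees T₁ and T₂ for two single nodes P, R and a chain S of three nodes

P R S : RootedTree
P = chain 0
R = chain 0
S = chain 2

-- Numbering of the nodes: in t₁, 0 is the root a, then y = 1, P = 2, R = 3,
-- and S = 4, 5, 6; in t₂, 0 is the root a, then P = 1, z = 2, R = 3 and S = 4, 5, 6.
t₁ t₂ : RootedTree
t₁ = join (join P R) S
t₂ = join P (join R S)

module O₁ = Order t₁
module O₂ = Order t₂

-- Order facts about the two trees, mostly by exhaustive check

strict-4-chain : ∀ w x y z → w O₁.≺ x → x O₁.≺ y → y O₁.≺ z → w ≡ 0F × x ≡ 4F × z ≡ 6F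
strict-4-chain = from-yes (all? λ w → all? λ x → all? λ y → all? λ z →
  (w O₁.≺? x) →-dec (x O₁.≺? y) →-dec (y O₁.≺? z) →-dec (w ≟ 0F) ×-dec (x ≟ 4F) ×-dec (z ≟ 6F))

-- The first four and the last four nodes would both end at `6F`.
¬strict-5-chain : ∀ {v w x y z} → v O₁.≺ w → w O₁.≺ x → x O₁.≺ y → y O₁.≺ z → ⊥
¬strict-5-chain v≺w w≺x x≺y y≺z@(_ , y≢z) =
  y≢z (trans (proj₂ (proj₂ (strict-4-chain _ _ _ _ v≺w w≺x x≺y)))
             (sym (proj₂ (proj₂ (strict-4-chain _ _ _ _ w≺x x≺y y≺z)))))

t₁-root-least : ∀ x → 0F O₁.≼ x
t₁-root-least = from-yes (all? λ x → 0F O₁.≼? x)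

t₁-above-S⊆chain : ∀ x → 4F O₁.≼ x → x O₁.≼ 6F
t₁-above-S⊆chain = from-yes (all? λ x → (4F O₁.≼? x) →-dec (x O₁.≼? 6F))

t₁-incomparable-to-S : ∀ x → ¬ (x O₁.≼ 4F) → ¬ (4F O₁.≼ x) → 1F O₁.≼ x
t₁-incomparable-to-S = from-yes (all? λ x →
  ¬? (x O₁.≼? 4F) →-dec ¬? (4F O₁.≼? x) →-dec (1F O₁.≼? x))

a≺z : 0F O₂.≺ 2F
a≺z = from-yes (0F O₂.≺? 2F)

z≺s₁ : 2F O₂.≺ 4F
z≺s₁ = from-yes (2F O₂.≺? 4F)

s₁≺s₂ : 4F O₂.≺ 5F
s₁≺s₂ = from-yes (4F O₂.≺? 5F)

s₂≺s₃ : 5F O₂.≺ 6F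
s₂≺s₃ = from-yes (5F O₂.≺? 6F)

≺₂-trans : ∀ x y z → x O₂.≺ y → y O₂.≺ z → x O₂.≺ z
≺₂-trans = from-yes (all? λ x → all? λ y → all? λ z →
  (x O₂.≺? y) →-dec (y O₂.≺? z) →-dec (x O₂.≺? z))

y⋠s₁ : ¬ (1F O₁.≼ 4F)
y⋠s₁ = from-no (1F O₁.≼? 4F)

z⋠p : ¬ (2F O₂.≼ 1F)
z⋠p = from-no (2F O₂.≼? 1F)

z≼r : 2F O₂.≼ 3F
z≼r = from-yes (2F O₂.≼? 3F)

p⋠s₁ : ¬ (1F O₂.≼ 4F)
p⋠s₁ = from-no (1F O₂.≼? 4F)

s₁⋠p : ¬ (4F O₂.≼ 1F)
s₁⋠p = from-no (4F O₂.≼? 1F)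

r⋠s₁ : ¬ (3F O₂.≼ 4F)
r⋠s₁ = from-no (3F O₂.≼? 4F)

s₁⋠r : ¬ (4F O₂.≼ 3F)
s₁⋠r = from-no (4F O₂.≼? 3F)

r⋠s₂ : ¬ (3F O₂.≼ 5F)
r⋠s₂ = from-no (3F O₂.≼? 5F)

r⋠s₃ : ¬ (3F O₂.≼ 6F)
r⋠s₃ = from-no (3F O₂.≼? 6F)

-- Common supertrees with at most eight nodes

module SmallSupertree {u : RootedTree}
  (e₁ : nonEmpty t₁ IsMinorOf nonEmpty u) (e₂ : nonEmpty t₂ IsMinorOf nonEmpty u)
  (u≤8 : ∣ nonEmpty u ∣ ≤ 8) where

  module U = Order u
  module E₁ = Embedding {t₁} {u} e₁
  module E₂ = Embedding {t₂} {u} e₂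

  Matched : Fin 7 → Set
  Matched y = ∃ λ x → E₁.f x ≡ E₂.f y

  matched? : ∀ y → Dec (Matched y)
  matched? y = any? λ x → E₁.f x ≟ E₂.f y

  -- The seven images of `t₁` miss at most one of the at most eight nodes of `u`.
  others-matched : ∀ {y} → ¬ Matched y → ∀ y′ → y′ ≢ y → Matched y′
  others-matched ¬my y′ y′≢y = decidable-stable (matched? y′) λ ¬my′ →
    y′≢y (E₂.f-injective (omits-at-most-one E₁.f-injective u≤8 ¬my′ ¬my))

  pull : ∀ {y y′} (m : Matched y) (m′ : Matched y′) → y O₂.≼ y′ → proj₁ m O₁.≼ proj₁ m′
  pull (_ , eq) (_ , eq′) p = E₁.f-cancel (subst₂ U._≼_ (sym eq) (sym eq′) (E₂.f-mono p))

  push : ∀ {y y′} (m : Matched y) (m′ : Matched y′) → proj₁ m O₁.≼ proj₁ m′ → y O₂.≼ y′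
  push (_ , eq) (_ , eq′) p = E₂.f-cancel (subst₂ U._≼_ eq eq′ (E₁.f-mono p))

  pull≺ : ∀ {y y′} (m : Matched y) (m′ : Matched y′) → y O₂.≺ y′ → proj₁ m O₁.≺ proj₁ m′
  pull≺ m m′ (p , y≢y′) = pull m m′ p ,
    λ eq → y≢y′ (E₂.f-injective (trans (sym (proj₂ m)) (trans (cong E₁.f eq) (proj₂ m′))))

  z-matched : Matched 2F
  z-matched = decidable-stable (matched? 2F) λ ¬z → absurd
    (others-matched ¬z 0F λ ()) (others-matched ¬z 1F λ ()) (others-matched ¬z 3F λ ())
    (others-matched ¬z 4F λ ()) (others-matched ¬z 5F λ ()) (others-matched ¬z 6F λ ())
    where
    absurd : Matched 0F → Matched 1F → Matched 3F → Matched 4F → Matched 5F → Matched 6F → ⊥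
    absurd a p r s₁ s₂ s₃ =
      -- The images of y and z are compared inside `u`, where both lie above the image of R.
      Sum.[ y-not-above-z , z-not-above-y ] (U.ancestors-comparable (E₁.f-mono (y≼ r r⋠s₁ s₁⋠r)) fz≼fr)
      where
      s₁↦s₁ : proj₁ s₁ ≡ 4F
      s₁↦s₁ = proj₁ (proj₂ (strict-4-chain _ _ _ _
        (pull≺ a s₁ (≺₂-trans _ _ _ a≺z z≺s₁)) (pull≺ s₁ s₂ s₁≺s₂) (pull≺ s₂ s₃ s₂≺s₃)))

      y≼ : ∀ {y} (m : Matched y) → ¬ (y O₂.≼ 4F) → ¬ (4F O₂.≼ y) → 1F O₁.≼ proj₁ m
      y≼ m y⋠s₁ s₁⋠y = t₁-incomparable-to-S (proj₁ m)
        (λ q → y⋠s₁ (push m s₁ (subst (proj₁ m O₁.≼_) (sym s₁↦s₁) q)))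
        (λ q → s₁⋠y (push s₁ m (subst (O₁._≼ proj₁ m) (sym s₁↦s₁) q)))

      fz≼fr : E₂.f 2F U.≼ E₁.f (proj₁ r)
      fz≼fr = subst (E₂.f 2F U.≼_) (sym (proj₂ r)) (E₂.f-mono z≼r)

      y-not-above-z : ¬ (E₁.f 1F U.≼ E₂.f 2F)
      y-not-above-z fy≼fz = y⋠s₁ (subst (1F O₁.≼_) s₁↦s₁
        (E₁.f-cancel (fy≼fz ◅◅ subst (E₂.f 2F U.≼_) (sym (proj₂ s₁)) (E₂.f-mono (proj₁ z≺s₁)))))

      z-not-above-y : ¬ (E₂.f 2F U.≼ E₁.f 1F)
      z-not-above-y fz≼fy = z⋠p
        (E₂.f-cancel (fz≼fy ◅◅ subst (E₁.f 1F U.≼_) (proj₂ p) (E₁.f-mono (y≼ p p⋠s₁ s₁⋠p))))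

  a-matched : Matched 0F
  a-matched = decidable-stable (matched? 0F) λ ¬a → absurd (others-matched ¬a 1F λ ())
    (others-matched ¬a 4F λ ()) (others-matched ¬a 5F λ ()) (others-matched ¬a 6F λ ())
    where
    absurd : Matched 1F → Matched 4F → Matched 5F → Matched 6F → ⊥
    absurd p s₁ s₂ s₃ = z⋠p (push z-matched p (subst (O₁._≼ proj₁ p) (sym z↦a) (t₁-root-least _)))
      where
      z↦a : proj₁ z-matched ≡ 0F
      z↦a = proj₁ (strict-4-chain _ _ _ _ (pull≺ z-matched s₁ z≺s₁) (pull≺ s₁ s₂ s₁≺s₂) (pull≺ s₂ s₃ s₂≺s₃))

  -- Here `v` and `w` are the two sᵢ left when the third is unmatched. The chain a, z, `v`, `w`
  -- forces z to `4F` and `w` to `6F`; R lies below z, so its match lies above `6F`, giving R above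
  -- `w`.
  ¬long-matched-chain : ∀ {v w} → 2F O₂.≺ v → v O₂.≺ w → ¬ (3F O₂.≼ w) →
                        Matched v → Matched w → Matched 3F → ⊥
  ¬long-matched-chain z≺v v≺w r⋠w mv mw mr =
    r⋠w (push mr mw (subst (proj₁ mr O₁.≼_) (sym w↦s₃)
      (t₁-above-S⊆chain _ (subst (O₁._≼ proj₁ mr) z↦s₁ (pull z-matched mr z≼r)))))
    where
    matched-chain = proj₂ (strict-4-chain _ _ _ _
      (pull≺ a-matched z-matched a≺z) (pull≺ z-matched mv z≺v) (pull≺ mv mw v≺w))

    z↦s₁ : proj₁ z-matched ≡ 4F
    z↦s₁ = proj₁ matched-chain

    w↦s₃ : proj₁ mw ≡ 6F
    w↦s₃ = proj₂ matched-chain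

  impossible : ⊥
  impossible with matched? 4F | matched? 5F | matched? 6F
  ... | yes s₁ | yes s₂ | yes s₃ = ¬strict-5-chain (pull≺ a-matched z-matched a≺z) (pull≺ z-matched s₁ z≺s₁)
                                           (pull≺ s₁ s₂ s₁≺s₂) (pull≺ s₂ s₃ s₂≺s₃)
  ... | no ¬s₁ | _ | _ = ¬long-matched-chain (≺₂-trans _ _ _ z≺s₁ s₁≺s₂) s₂≺s₃ r⋠s₃
    (others-matched ¬s₁ 5F λ ()) (others-matched ¬s₁ 6F λ ()) (others-matched ¬s₁ 3F λ ())
  ... | _ | no ¬s₂ | _ = ¬long-matched-chain z≺s₁ (≺₂-trans _ _ _ s₁≺s₂ s₂≺s₃) r⋠s₃
    (others-matched ¬s₂ 4F λ ()) (others-matched ¬s₂ 6F λ ()) (others-matched ¬s₂ 3F λ ())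
  ... | _ | _ | no ¬s₃ = ¬long-matched-chain z≺s₁ s₁≺s₂ r⋠s₂
    (others-matched ¬s₃ 4F λ ()) (others-matched ¬s₃ 5F λ ()) (others-matched ¬s₃ 3F λ ())

-- Size bounds

supertree-size : ∀ U → IsCommonSupertree (tree₁ P R S) (tree₂ P R S) U → ∣ U ∣ > 8
supertree-size empty        ((f , _) , _) = ⊥-elim (¬Fin0 (Injection.to f zero))
supertree-size (nonEmpty u) (e₁ , e₂)     = ≰⇒> (SmallSupertree.impossible {u} e₁ e₂)

-- With seven or more nodes the embedding into `t₂` would be onto, so the strict chain of five nodes
-- in `t₂` would transfer through the minor to `t₁`.
minor-size : ∀ M → IsCommonMinor (tree₁ P R S) (tree₂ P R S) M → ∣ M ∣ ≤ 6
minor-size empty        _         = z≤n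
minor-size (nonEmpty m) (e₁ , e₂) = ≮⇒≥ λ 7≤m →
  let
    onto = injective∧≤⇒surjective E₂.f-injective 7≤m
    pull≺ : ∀ {y y′} → y O₂.≺ y′ → E₁.f (proj₁ (onto y)) O₁.≺ E₁.f (proj₁ (onto y′))
    pull≺ {y} {y′} = λ (p , y≢y′) →
      E₁.f-mono (E₂.f-cancel (subst₂ O₂._≼_ (sym (proj₂ (onto y))) (sym (proj₂ (onto y′))) p)) ,
      λ eq → y≢y′ (trans (sym (proj₂ (onto y))) (trans (cong E₂.f (E₁.f-injective eq)) (proj₂ (onto y′))))
  in ¬strict-5-chain (pull≺ a≺z) (pull≺ z≺s₁) (pull≺ s₁≺s₂) (pull≺ s₂≺s₃)
  where
  module E₁ = Embedding {m} {t₁} e₁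
  module E₂ = Embedding {m} {t₂} e₂

-- Explicit common minor and supertree

injective? : ∀ {m n} (f : Fin m → Fin n) → Dec (∀ i j → f i ≡ f j → i ≡ j)
injective? f = all? λ i → all? λ j → (f i ≟ f j) →-dec (i ≟ j)

indexed↣ : ∀ {m n} (xs : Vec (Fin n) m) → True (injective? (Vec.lookup xs)) → Fin m ↣ Fin n
indexed↣ xs inj = mk↣ {to = Vec.lookup xs} (λ {i} {j} → toWitness inj i j)

minorBy : ∀ {s t} (xs : Vec (Node (RootedTree.digraph t)) ∣ nonEmpty s ∣)
          {inj : True (injective? (Vec.lookup xs))} →
          {True (isMinorEmbedding? s t (indexed↣ xs inj))} → nonEmpty s IsMinorOf nonEmpty t
minorBy xs {inj} {emb} = indexed↣ xs inj , toWitness emb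

-- A root with children P, R and S.
μ : RootedTree
μ = parentTree parent (from-yes (all? λ v → toℕ (parent v) ≤? toℕ v))
  where
  parent : Fin 5 → Fin 6
  parent = Vec.lookup (0F ∷ 0F ∷ 0F ∷ 3F ∷ 4F ∷ [])

-- Nine nodes: y and z both occur, each with its own copy of R.
σ : RootedTree
σ = join (join P R) (join R S)

μ-commonMinor : IsCommonMinor (tree₁ P R S) (tree₂ P R S) (nonEmpty μ)
-- The omitted node is y, that is `1F`, in `t₁` and z, that is `2F`, in `t₂`.
μ-commonMinor = minorBy {μ} {t₁} (0F ∷ 2F ∷ 3F ∷ 4F ∷ 5F ∷ 6F ∷ [])
              , minorBy {μ} {t₂} (0F ∷ 1F ∷ 3F ∷ 4F ∷ 5F ∷ 6F ∷ [])

σ-commonSupertree : IsCommonSupertree (tree₁ P R S) (tree₂ P R S) (nonEmpty σ)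
σ-commonSupertree = minorBy {t₁} {σ} (0F ∷ 1F ∷ 2F ∷ 3F ∷ 6F ∷ 7F ∷ 8F ∷ [])
                  , minorBy {t₂} {σ} (0F ∷ 2F ∷ 4F ∷ 5F ∷ 6F ∷ 7F ∷ 8F ∷ [])

mainTheorem1 : (∃[ P ] ∃[ R ] ∃[ S ]
    (¬ (P ≅ S))
    × (∀ (Tμ : Tree) → IsLargestCommonMinor (tree₁ P R S) (tree₂ P R S) Tμ → ∣ Tμ ∣ ≡ ∣ tree₁ P R S ∣ ∸ 1)
    × (∀ (Tσ : Tree) → IsSmallestCommonSupertree (tree₁ P R S) (tree₂ P R S) Tσ → ∣ Tσ ∣ > ∣ tree₁ P R S ∣ + 1))
    × (¬ (∀ (T₁ T₂ Tμ Tσ : Tree) → IsLargestCommonMinor T₁ T₂ Tμ → IsSmallestCommonSupertree T₁ T₂ Tσ → ∣ Tσ ∣ ≡ (∣ T₁ ∣ + ∣ T₂ ∣) ∸ ∣ Tμ ∣))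
mainTheorem1 =
  ( P , R , S
  , (λ (f , _) → case ↔⇒≡ f of λ ())
  , (λ M (common , largest) → ≤-antisym (minor-size M common) (largest (nonEmpty μ) μ-commonMinor))
  , (λ U (common , _) → supertree-size U common))
  -- The equality would read 9 = 7 + 7 - 6.
  , λ equality → case equality (tree₁ P R S) (tree₂ P R S) (nonEmpty μ) (nonEmpty σ)
      (μ-commonMinor , minor-size) (σ-commonSupertree , supertree-size) of λ ()
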